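{- Let $m\ge 1$, let $a_1<\cdots<a_m$ be $m$ primary colors, and let $u_1,\dots,u_m,n$ be non-negative integers. Let $\mathcal{C}(u_1,\dots,u_m,n)$ be the set of partitions of $n$ into parts colored by primary colors, with exactly $u_k$ parts of color $a_k$ for each $k$, the parts of the same color being distinct. Let $\mathcal{D}(u_1,\dots,u_m,n)$ be the set of partitions $\lambda_1+\cdots+\lambda_s$ of $n$ into parts colored by primary and secondary colors, such that $\lambda_1\gg_c\lambda_2\gg_c\cdots\gg_c\lambda_s$, no part is equal to $1_{a_ia_j}$ for any $i,j$ (that is, no part with a secondary color has size $1$), and for each $i$ the number $u_i$ equals the number of parts colored by $a_i$, $a_ia_j$ or $a_ja_i$ with $j\neq i$, plus twice the number of parts colored by $a_i^2=a_ia_i$. Then $$\sharp\,\mathcal{C}(u_1,\dots,u_m,n)=\sharp\,\mathcal{D}(u_1,\dots,u_m,n).$$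
   Context: Write $\chi(A)=1$ if the statement $A$ is true and $\chi(A)=0$ otherwise. The set of primary colors is $\{a_1,\dots,a_m\}$, totally ordered by $a_1<\cdots<a_m$. There are $m^2$ secondary colors $a_ia_j$, $i,j\in\{1,\dots,m\}$; $a_ia_j$ and $a_ja_i$ are different colors when $i\ne j$. A colored part is a positive integer (its size) together with a color, written $k_p$ (size $k$, primary color $p$) or $k_{pq}$ (size $k$, secondary color $pq$); the secondary color $pq$ may only color sizes $k$ having the same parity as $\chi(p\le q)$. A partition of $n$ into colored parts is a finite collection of colored parts whose sizes add up to $n$. The relation $\gg_c$ on colored parts is defined as follows, for primary colors $p,q,r,t$ and sizes $k,l$ (the actual sizes of the parts, of the allowed parity when the color is secondary): - $k_p\gg_c l_q \iff k-l\ge 1+\chi(p\le q)$; - $k_p\gg_c l_{qr}\iff k-l\ge \chi(p\le q)+\chi(q\le r)$; - $k_{pq}\gg_c l_r\iff k-l\ge 1+\chi(p\le q)+\chi(q\le r)$; - $k_{pq}\gg_c l_{rt}\iff k-l\ge \chi(p\le q)+2\chi(q\le r)+\chi(r\le t)$. -}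

module Defs where

open import Data.Fin using (Fin; _≤?_)
import Data.Fin as Fin
open import Data.Fin.Properties using (any?)
open import Data.List using (List; filter; length; map; sum)
open import Data.List.Relation.Unary.All using (All)
open import Data.List.Relation.Unary.AllPairs using (AllPairs)
open import Data.List.Relation.Unary.Linked using (Linked)
open import Data.List.Relation.Binary.Permutation.Propositional using (↭-setoid)
open import Data.Bool using (if_then_else_)
open import Data.Nat using (ℕ; _+_; _*_; _≤_; _%_; NonZero)
open import Data.Product using (Σ; ∃; _×_; proj₁)
open import Data.Sum using (_⊎_)
open import Data.Unit using (⊤)
open import Function using (_∘_)
open import Function.Bundles using (Bijection)
open import Level using (0ℓ)
open import Relation.Binary.Bundles using (Setoid)
open import Relation.Binary.Definitions using (DecidableEquality)
import Relation.Binary.Construct.On as On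
open import Relation.Binary.PropositionalEquality
  using (_≡_; _≢_; refl; setoid)
open import Relation.Nullary
  using (¬_; Dec; yes; no; does; ¬?; _×-dec_; _⊎-dec_)
open import Relation.Unary using (Pred; Decidable)

χ : {A : Set} → Dec A → ℕ
χ A? = if does A? then 1 else 0

-- The primary colors a₁ < ⋯ < aₘ are the elements of Fin m in their usual
-- order; secondary p q is the color pq.
data Color (m : ℕ) : Set where
  primary   : Fin m → Color m
  secondary : Fin m → Fin m → Color m

module _ {m : ℕ} where

  _≟_ : DecidableEquality (Color m)
  primary p     ≟ primary q     with p Fin.≟ q
  ... | yes refl = yes refl
  ... | no p≢q   = no λ { refl → p≢q refl }
  primary _     ≟ secondary _ _ = no λ ()
  secondary _ _ ≟ primary _     = no λ ()
  secondary p q ≟ secondary r t with p Fin.≟ r | q Fin.≟ t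
  ... | yes refl | yes refl = yes refl
  ... | no p≢r   | _        = no λ { refl → p≢r refl }
  ... | yes _    | no q≢t   = no λ { refl → q≢t refl }

  MayColor : Color m → ℕ → Set
  MayColor (primary _)     k = ⊤
  MayColor (secondary p q) k = k % 2 ≡ χ (p ≤? q) % 2

-- The side conditions are irrelevant, so that parts are equal as soon as
-- their sizes and colors are.
record Part (m : ℕ) : Set where
  constructor part
  field
    size              : ℕ
    color             : Color m
    .{{size-nonZero}} : NonZero size
    .allowed          : MayColor color size

open Part public using (size; color)

module _ {m : ℕ} where

  minGap : Color m → Color m → ℕ
  minGap (primary p)     (primary q)     = 1 + χ (p ≤? q)
  minGap (primary p)     (secondary q r) = χ (p ≤? q) + χ (q ≤? r)
  minGap (secondary p q) (primary r)     = 1 + χ (p ≤? q) + χ (q ≤? r)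
  minGap (secondary p q) (secondary r t) =
    χ (p ≤? q) + 2 * χ (q ≤? r) + χ (r ≤? t)

  -- size x − size y ≥ minGap, with the subtraction moved across because
  -- truncated subtraction would be wrong when size x < size y.
  infix 4 _≫_
  _≫_ : Part m → Part m → Set
  x ≫ y = minGap (color x) (color y) + size y ≤ size x

  IsPrimary IsSecondary : Color m → Set
  IsPrimary   c = ∃ λ i → c ≡ primary i
  IsSecondary c = ∃ λ i → ∃ λ j → c ≡ secondary i j

  InvolvesOnce : Fin m → Color m → Set
  InvolvesOnce i c =
    c ≡ primary i ⊎
    ∃ λ j → j ≢ i × (c ≡ secondary i j ⊎ c ≡ secondary j i)

  involvesOnce? : ∀ i → Decidable (InvolvesOnce i)
  involvesOnce? i c =
    (c ≟ primary i) ⊎-dec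
    any? λ j → ¬? (j Fin.≟ i) ×-dec
               ((c ≟ secondary i j) ⊎-dec (c ≟ secondary j i))

  #colored : {P : Pred (Color m) 0ℓ} → Decidable P → List (Part m) → ℕ
  #colored P? xs = length (filter (P? ∘ color) xs)

-- A partition is a multiset of parts: a list of parts, considered up to
-- permutation (see Partitions below).
record Partition (m n : ℕ) : Set where
  constructor partition
  field
    parts : List (Part m)
    total : sum (map size parts) ≡ n

open Partition public

module _ {m n : ℕ} where

  record InC (u : Fin m → ℕ) (π : Partition m n) : Set where
    field
      allPrimary : All (IsPrimary ∘ color) (parts π)
      counts     : ∀ i → #colored (_≟ primary i) (parts π) ≡ u i
      distinct   : AllPairs (λ x y → color x ≡ color y → size x ≢ size y) (parts π)

  -- Here the list order is the order λ₁, λ₂, …, λₛ of the chain for _≫_.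
  record InD (u : Fin m → ℕ) (π : Partition m n) : Set where
    field
      chain  : Linked _≫_ (parts π)
      no-1   : All (λ x → ¬ (IsSecondary (color x) × size x ≡ 1)) (parts π)
      counts : ∀ i → u i ≡ #colored (involvesOnce? i) (parts π)
                           + 2 * #colored (_≟ secondary i i) (parts π)

  -- Two elements are equal when their
  -- parts agree as multisets, whatever the proofs of P.
  Partitions : Pred (Partition m n) 0ℓ → Setoid 0ℓ 0ℓ
  Partitions P =
    On.setoid {B = Σ (Partition m n) P} (↭-setoid {A = Part m}) (parts ∘ proj₁)

𝒞 𝒟 : {m : ℕ} → (Fin m → ℕ) → ℕ → Setoid 0ℓ 0ℓ
𝒞 {m} u n = Partitions {m} {n} (InC u)
𝒟 {m} u n = Partitions {m} {n} (InD u)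

HasCardinality : Setoid 0ℓ 0ℓ → ℕ → Set
HasCardinality S N = Bijection (setoid (Fin N)) S

{-# OPTIONS --safe #-}
module Submission where

-- Fix the word c₁ … cₛ of primary colors read off a partition from its
-- largest part to its smallest, a secondary color pq contributing the two
-- letters p q. The bijection between 𝒞 and 𝒟 preserves this word.
--
-- Let energy (c₁ … cₛ) be the number of i with cᵢ ≤ cᵢ₊₁. A partition in 𝒞,
-- put in decreasing order of size and then of color, has consecutive parts
-- k of color p and l of color q with k − l ≥ χ(p ≤ q). Subtracting from
-- every part the energy of the suffix of the word that starts at it (and 1,
-- for positivity) turns these partitions into arbitrary weakly decreasing
-- sequences of natural numbers along the word (place, sorted⇒place).
-- Grouping equal values into pairs, as far as possible, turns such a
-- sequence into strictly decreasing singles x interleaved with weakly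
-- decreasing pairs y.
--
-- A chain in 𝒟 is normalized in the same way: a part of secondary color pq
-- is the sum of a part of color p and a part of color q whose sizes differ
-- by χ(p ≤ q), so that both normalize to the same value y. The four cases
-- of the definition of ≫ become (fits⇔≫):
--   consecutive singles x, x′ satisfy x > x′;
--   consecutive pairs y, y′ satisfy y ≥ y′;
--   a single x is followed by a pair y only if x ≥ 1 + 2y + E;
--   a pair y is followed by a single x only if x < 1 + 2y + E,
-- where E is the energy of the suffix of the word that starts at the second of
-- the three letters of the two blocks. Hence the sequences in 𝒟 are again
-- interleavings of strictly decreasing singles with weakly decreasing pairs;
-- only the threshold that decides which of x and y comes first is different
-- (for 𝒞 it is x ≥ y).
--
-- For both thresholds, given the word, the singles and the pairs, there is
-- exactly one admissible interleaving (reorder-good, good-unique). Indeed the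
-- conditions on neighbouring blocks imply those on distant blocks, because
-- the threshold changes by at most 1 per letter (fits⇒good), and so it is
-- forced whether the first single or the first pair comes first. Passing from
-- one interleaving to the other is a bijection. It preserves the weight, which
-- is the sum of the singles, plus twice the sum of the pairs, plus a
-- quantity that depends on the word alone (weight-chainOf).
--
-- The common cardinality is the number of normalized sequences in 𝒞, which
-- are listed explicitly. In both 𝒞 and 𝒟 each multiset has only one
-- admissible order of its parts, because that order is strictly decreasing
-- for the same strict order ⊐.

open import Defs
open import Level using (0ℓ)
open import Data.Fin using (Fin)
import Data.Fin as Fin
import Data.Fin.Properties as Finₚ
open import Data.Nat using (ℕ; zero; suc; _+_; _*_; _∸_; _≤_; _<_; _>_; _≥_; _≤?_; z≤n; s≤s; _%_; _/_; NonZero; >-nonZero⁻¹)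
import Data.Nat as ℕ
open import Data.Nat.Properties hiding (_≟_)
open import Data.Nat.DivMod using (m≡m%n+[m/n]*n; m<n⇒m%n≡m; [m+kn]%n≡m%n)
open import Data.Nat.Tactic.RingSolver using (solve-∀)
open import Data.List using (List; []; _∷_; foldr; map; length; lookup; filter; allFin; upTo; cartesianProduct; cartesianProductWith)
open import Data.Nat.ListAction using (sum)
open import Data.Nat.ListAction.Properties using (sum-↭)
open import Data.List.Membership.Propositional using (_∈_)
open import Data.List.Membership.Propositional.Properties
  using (∈-lookup; ∈-allFin; ∈-upTo⁺; ∈-filter⁺; ∈-filter⁻; ∈-cartesianProduct⁺; ∈-cartesianProductWith⁺)
open import Data.List.Properties using (∷-injective; ∷-injectiveˡ; ∷-injectiveʳ)
open import Data.List.Relation.Unary.Any using (here; there; index)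
open import Data.List.Relation.Unary.Any.Properties using (lookup-index)
import Data.List.Relation.Unary.All as All
import Data.List.Relation.Unary.All.Properties as Allₚ
open import Data.List.Relation.Unary.All using (All; []; _∷_) renaming (map to All-map)
open import Data.List.Relation.Unary.AllPairs using (AllPairs; []; _∷_; allPairs?)
import Data.List.Relation.Unary.AllPairs as AllPairs
open import Data.List.Relation.Unary.Linked using (Linked; []; [-]; _∷_)
import Data.List.Relation.Unary.Linked as Linked
open import Data.List.Relation.Unary.Linked.Properties using (Linked⇒AllPairs; AllPairs⇒Linked)
open import Data.List.Relation.Unary.Unique.Propositional using (Unique)
import Data.List.Relation.Unary.Unique.Propositional.Properties as Uniqueₚ
open import Data.List.Relation.Binary.Permutation.Propositional using (_↭_; prep; swap; ↭-refl; ↭-sym; ↭-trans)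
open import Data.List.Relation.Binary.Permutation.Propositional.Properties
  using (¬x∷xs↭[]; All-resp-↭; ∈-resp-↭; drop-∷; filter-↭; ↭-length)
  renaming (map⁺ to ↭-map)
open import Data.Product using (_×_; _,_; proj₁; proj₂; ∃; Σ)
open import Data.Sum using (_⊎_; inj₁; inj₂)
open import Data.Unit using (⊤; tt)
open import Function using (_∘_)
open import Function.Bundles using (_⇔_; mk⇔; Equivalence)
open import Relation.Nullary using (¬_; Dec; yes; no; contradiction; _×-dec_; recompute; map′)
open import Relation.Unary using (Pred; Decidable)
open import Relation.Binary.Core using (Rel)
open import Relation.Binary.Definitions using (Transitive; Asymmetric; tri<; tri≈; tri>)
open import Relation.Binary.PropositionalEquality

-- Arithmetic of indicators and of doubled numbers

χ≤1 : ∀ {A : Set} (A? : Dec A) → χ A? ≤ 1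
χ≤1 (yes _) = ≤-refl
χ≤1 (no _)  = z≤n

double-cancel-≤ : ∀ {a b} → a + a ≤ suc (b + b) → a ≤ b
double-cancel-≤ {a} {b} le with a ≤? b
... | yes a≤b = a≤b
... | no  a≰b = contradiction
  (≤-trans (s≤s (≤-reflexive (sym (+-suc b b))))
           (≤-trans (+-mono-≤ (≰⇒> a≰b) (≰⇒> a≰b)) le))
  (<-irrefl refl)

-- Adding k on both sides, in the form used to simplify an instance of ≫: the
-- two equations are left to a ring solver.
shift-≤ : ∀ k {p q a b} → a ≡ k + p → b ≡ k + q → p ≤ q ⇔ a ≤ b
shift-≤ k refl refl = mk⇔ (+-monoʳ-≤ k) (+-cancelˡ-≤ k _ _)

double-cancel-< : ∀ {a b} → suc (a + a) ≤ b + b → a < b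
double-cancel-< {a} {b} lt with suc a ≤? b
... | yes a<b = a<b
... | no  a≮b = contradiction (<-≤-trans lt (+-mono-≤ (≮⇒≥ a≮b) (≮⇒≥ a≮b))) (<-irrefl refl)

-- The parity that a secondary color prescribes splits the size into two halves
-- that differ by the indicator.
even-part : ∀ {A : Set} (A? : Dec A) {k} → k % 2 ≡ χ A? % 2 → k ≡ χ A? + (k / 2) * 2
even-part A? {k} parity =
  trans (m≡m%n+[m/n]*n k 2)
        (cong (_+ (k / 2) * 2) (trans parity (m<n⇒m%n≡m (s≤s (χ≤1 A?)))))

below : ∀ {a b} → a < b → ∃ λ x → b ≡ suc (x + a)
below {a} {b} a<b = b ∸ suc a , trans (sym (m∸n+n≡m a<b)) (+-suc (b ∸ suc a) a)

χ-yes : ∀ {A : Set} (A? : Dec A) → A → χ A? ≡ 1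
χ-yes (yes _) _ = refl
χ-yes (no ¬a) a = contradiction a ¬a

χ-no : ∀ {A : Set} (A? : Dec A) → ¬ A → χ A? ≡ 0
χ-no (yes a) ¬a = contradiction a ¬a
χ-no (no _)  _  = refl

χ-cong : ∀ {A B : Set} {A? : Dec A} {B? : Dec B} → A ⇔ B → χ A? ≡ χ B?
χ-cong {A? = A?} {yes b} A⇔B = χ-yes A? (Equivalence.from A⇔B b)
χ-cong {A? = A?} {no ¬b} A⇔B = χ-no A? (¬b ∘ Equivalence.to A⇔B)

-- Interleavings of singles and pairs

-- A list of blocks cuts the word of its colors into factors of length one
-- and two. Every block carries one normalized value; that of a pair stands
-- for two equal values.
data Block (A : Set) : Set where
  single : A → ℕ → Block A
  pair   : A → A → ℕ → Block A

module _ {A : Set} where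

  word : List (Block A) → List A
  word []               = []
  word (single c _ ∷ s) = c ∷ word s
  word (pair c d _ ∷ s) = c ∷ d ∷ word s

  singles pairs : List (Block A) → List ℕ
  singles []               = []
  singles (single _ x ∷ s) = x ∷ singles s
  singles (pair _ _ _ ∷ s) = singles s
  pairs []               = []
  pairs (single _ _ ∷ s) = pairs s
  pairs (pair _ _ y ∷ s) = y ∷ pairs s

  -- Two arrangements of the same singles and the same pairs along the same
  -- word.
  record _∼_ (s t : List (Block A)) : Set where
    field
      word≡    : word s ≡ word t
      singles≡ : singles s ≡ singles t
      pairs≡   : pairs s ≡ pairs t

  open _∼_ public

  ∼-trans : ∀ {s t v} → s ∼ t → t ∼ v → s ∼ v
  ∼-trans p q = record
    { word≡    = trans (word≡ p) (word≡ q)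
    ; singles≡ = trans (singles≡ p) (singles≡ q)
    ; pairs≡   = trans (pairs≡ p) (pairs≡ q) }

  ∼-sym : ∀ {s t} → s ∼ t → t ∼ s
  ∼-sym p = record
    { word≡ = sym (word≡ p) ; singles≡ = sym (singles≡ p) ; pairs≡ = sym (pairs≡ p) }

  ∼-refl : ∀ {s} → s ∼ s
  ∼-refl = record { word≡ = refl ; singles≡ = refl ; pairs≡ = refl }

  ∼-swap : ∀ {c d e x y s} →
           (pair c d y ∷ single e x ∷ s) ∼ (single c x ∷ pair d e y ∷ s)
  ∼-swap = record { word≡ = refl ; singles≡ = refl ; pairs≡ = refl }

  ∼-∷ : ∀ b {s t} → s ∼ t → (b ∷ s) ∼ (b ∷ t)
  ∼-∷ (single c x) p = record
    { word≡ = cong (c ∷_) (word≡ p) ; singles≡ = cong (x ∷_) (singles≡ p) ; pairs≡ = pairs≡ p }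
  ∼-∷ (pair c d y) p = record
    { word≡ = cong (λ w → c ∷ d ∷ w) (word≡ p) ; singles≡ = singles≡ p ; pairs≡ = cong (y ∷_) (pairs≡ p) }

  -- A single x and a pair y that compete for the first place of an
  -- arrangement of the word c ∷ w come in the order single, pair exactly when
  -- T w y ≤ x.
  record IsThreshold (T : List A → ℕ → ℕ) : Set where
    field
      mono   : ∀ w {y y′} → y ≤ y′ → T w y ≤ T w y′
      grow   : ∀ c w y → T w y ≤ T (c ∷ w) y
      grow≤1 : ∀ c w y → T (c ∷ w) y ≤ suc (T w y)
      cancel : ∀ c d w {y y′} → T w y < T (c ∷ d ∷ w) y′ → y ≤ y′

  module Arrangement {T : List A → ℕ → ℕ} (isThreshold : IsThreshold T) where
    open IsThreshold isThreshold

    -- The singles decrease strictly, the pairs decrease weakly, and every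
    -- single is compared with every pair by the threshold at the place of
    -- the earlier one of the two.
    data Good : List (Block A) → Set where
      []      : Good []
      single∷ : ∀ {c x s} → All (_< x) (singles s) →
                All (λ y → T (word s) y ≤ x) (pairs s) →
                Good s → Good (single c x ∷ s)
      pair∷   : ∀ {c d y s} → All (_< T (d ∷ word s) y) (singles s) →
                All (_≤ y) (pairs s) →
                Good s → Good (pair c d y ∷ s)

    good-tail : ∀ {b s} → Good (b ∷ s) → Good s
    good-tail (single∷ _ _ g) = g
    good-tail (pair∷ _ _ g)   = g

    good⇒singles↘ : ∀ {s} → Good s → AllPairs _>_ (singles s)
    good⇒singles↘ []               = []
    good⇒singles↘ (single∷ ss _ g) = ss ∷ good⇒singles↘ g
    good⇒singles↘ (pair∷ _ _ g)    = good⇒singles↘ g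

    good⇒pairs↘ : ∀ {s} → Good s → AllPairs _≥_ (pairs s)
    good⇒pairs↘ []              = []
    good⇒pairs↘ (single∷ _ _ g) = good⇒pairs↘ g
    good⇒pairs↘ (pair∷ _ ps g)  = ps ∷ good⇒pairs↘ g

    -- The part of Good (b ∷ s) that concerns b and the first block of s.
    Fits : Block A → List (Block A) → Set
    Fits _            []                  = ⊤
    Fits (single _ x) (single _ x′ ∷ _)   = x′ < x
    Fits (single _ x) (pair d e y ∷ s)    = T (d ∷ e ∷ word s) y ≤ x
    Fits (pair _ d y) (single e x ∷ s)    = x < T (d ∷ e ∷ word s) y
    Fits (pair _ _ y) (pair _ _ y′ ∷ _)   = y′ ≤ y

    good⇒fits : ∀ {b s} → Good (b ∷ s) → Fits b s
    good⇒fits {single _ _} {[]}             _                       = tt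
    good⇒fits {pair _ _ _} {[]}             _                       = tt
    good⇒fits {single _ _} {single _ _ ∷ _} (single∷ (x′<x ∷ _) _ _) = x′<x
    good⇒fits {single _ _} {pair _ _ _ ∷ _} (single∷ _ (T≤x ∷ _) _)  = T≤x
    good⇒fits {pair _ _ _} {single _ _ ∷ _} (pair∷ (x<T ∷ _) _ _)    = x<T
    good⇒fits {pair _ _ _} {pair _ _ _ ∷ _} (pair∷ _ (y′≤y ∷ _) _)   = y′≤y

    -- Comparing neighbours suffices. The bounds on the growth of T say that
    -- the threshold moves more slowly than a strictly decreasing run of
    -- singles, and that a single cannot bring two pairs out of order.
    fits⇒good : ∀ {b s} → Fits b s → Good s → Good (b ∷ s)
    fits⇒good {single _ _} {[]} _ _ = single∷ [] [] []
    fits⇒good {pair _ _ _} {[]} _ _ = pair∷ [] [] []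
    fits⇒good {single _ x} {single c x′ ∷ s} x′<x g@(single∷ ss ps _) =
      single∷ (x′<x ∷ All-map (λ <x′ → <-trans <x′ x′<x) ss)
              (All-map (λ T≤x′ → ≤-trans (grow≤1 c (word s) _)
                                         (≤-trans (s≤s T≤x′) x′<x)) ps)
              g
    fits⇒good {single _ x} {pair d e y ∷ s} T≤x g@(pair∷ ss ps _) =
      single∷ (All-map (λ <T → <-≤-trans <T (≤-trans (grow d (e ∷ word s) y) T≤x)) ss)
              (T≤x ∷ All-map (λ y′≤y → ≤-trans (mono (d ∷ e ∷ word s) y′≤y) T≤x) ps)
              g
    fits⇒good {pair _ d y} {single e x ∷ s} x<T g@(single∷ ss ps _) =
      pair∷ (x<T ∷ All-map (λ <x → <-trans <x x<T) ss)
            (All-map (λ T≤x → cancel d e (word s) (≤-<-trans T≤x x<T)) ps)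
            g
    fits⇒good {pair _ c y} {pair d e y′ ∷ s} y′≤y g@(pair∷ ss ps _) =
      pair∷ (All-map (λ <T → <-≤-trans <T (≤-trans (mono (e ∷ word s) y′≤y)
                               (≤-trans (grow d (e ∷ word s) y)
                                        (grow c (d ∷ e ∷ word s) y)))) ss)
            (y′≤y ∷ All-map (λ ≤y′ → ≤-trans ≤y′ y′≤y) ps)
            g

    -- A new block sinks past the blocks that have to precede it. When a
    -- single and a pair change places, the letters under them stay put, so
    -- the pair takes over a letter of the single.
    insertSingle : A → ℕ → List (Block A) → List (Block A)
    insertSingle c x (pair d e y ∷ s) with T (d ∷ e ∷ word s) y ≤? x
    ... | yes _ = single c x ∷ pair d e y ∷ s
    ... | no _  = pair c d y ∷ insertSingle e x s
    insertSingle c x s = single c x ∷ s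

    insertPair : A → A → ℕ → List (Block A) → List (Block A)
    insertPair c d y (single e x ∷ s) with T (d ∷ e ∷ word s) y ≤? x
    ... | yes _ = single c x ∷ insertPair d e y s
    ... | no _  = pair c d y ∷ single e x ∷ s
    insertPair c d y s = pair c d y ∷ s

    insertSingle-∼ : ∀ c x s → insertSingle c x s ∼ (single c x ∷ s)
    insertSingle-∼ c x []               = ∼-refl
    insertSingle-∼ c x (single _ _ ∷ s) = ∼-refl
    insertSingle-∼ c x (pair d e y ∷ s) with T (d ∷ e ∷ word s) y ≤? x
    ... | yes _ = ∼-refl
    ... | no _  = ∼-trans (∼-∷ (pair c d y) (insertSingle-∼ e x s))
                          ∼-swap

    insertPair-∼ : ∀ c d y s → insertPair c d y s ∼ (pair c d y ∷ s)
    insertPair-∼ c d y []               = ∼-refl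
    insertPair-∼ c d y (pair _ _ _ ∷ s) = ∼-refl
    insertPair-∼ c d y (single e x ∷ s) with T (d ∷ e ∷ word s) y ≤? x
    ... | yes _ = ∼-trans (∼-∷ (single c x) (insertPair-∼ d e y s))
                          (∼-sym ∼-swap)
    ... | no _  = ∼-refl

    insertSingle-good : ∀ c {x s} → All (_< x) (singles s) → Good s →
                        Good (insertSingle c x s)
    insertSingle-good c {s = []}             _  g = fits⇒good tt g
    insertSingle-good c {s = single _ _ ∷ _} (x′<x ∷ _) g = fits⇒good x′<x g
    insertSingle-good c {x} {pair d e y ∷ s} ss g@(pair∷ ss<T ps g′)
      with T (d ∷ e ∷ word s) y ≤? x
    ... | yes T≤x = fits⇒good T≤x g
    ... | no  T≰x = pair∷
      (subst₂ (λ w → All (_< T (d ∷ w) y)) (sym (word≡ ∼ins)) (sym (singles≡ ∼ins))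
        (≰⇒> T≰x ∷ All-map (λ <T → <-≤-trans <T (grow d (e ∷ word s) y)) ss<T))
      (subst (All (_≤ y)) (sym (pairs≡ ∼ins)) ps)
      (insertSingle-good e ss g′)
      where ∼ins = insertSingle-∼ e x s

    insertPair-good : ∀ c d {y s} → All (_≤ y) (pairs s) → Good s →
                      Good (insertPair c d y s)
    insertPair-good c d {s = []}             _          g = fits⇒good tt g
    insertPair-good c d {s = pair _ _ _ ∷ _} (y′≤y ∷ _) g = fits⇒good y′≤y g
    insertPair-good c d {y} {single e x ∷ s} ps g@(single∷ ss ps≤x g′)
      with T (d ∷ e ∷ word s) y ≤? x
    ... | no  T≰x = fits⇒good (≰⇒> T≰x) g
    ... | yes T≤x = single∷
      (subst (All (_< x)) (sym (singles≡ ∼ins)) ss)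
      (subst₂ (λ w → All (λ y′ → T w y′ ≤ x)) (sym (word≡ ∼ins)) (sym (pairs≡ ∼ins))
        (T≤x ∷ All-map (λ y′≤y → ≤-trans (mono (d ∷ e ∷ word s) y′≤y) T≤x) ps))
      (insertPair-good d e ps g′)
      where ∼ins = insertPair-∼ d e y s

    insert : Block A → List (Block A) → List (Block A)
    insert (single c x) = insertSingle c x
    insert (pair c d y) = insertPair c d y

    -- The insertion sort that turns any list of blocks into a good one.
    reorder : List (Block A) → List (Block A)
    reorder = foldr insert []

    reorder-∼ : ∀ s → reorder s ∼ s
    reorder-∼ [] = ∼-refl
    reorder-∼ (b@(single c x) ∷ s) =
      ∼-trans (insertSingle-∼ c x (reorder s)) (∼-∷ b (reorder-∼ s))
    reorder-∼ (b@(pair c d y) ∷ s) =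
      ∼-trans (insertPair-∼ c d y (reorder s)) (∼-∷ b (reorder-∼ s))

    reorder-good : ∀ s → AllPairs _>_ (singles s) → AllPairs _≥_ (pairs s) →
                   Good (reorder s)
    reorder-good [] _ _ = []
    reorder-good (single c x ∷ s) (ss ∷ sss) pps =
      insertSingle-good c (subst (All (_< x)) (sym (singles≡ (reorder-∼ s))) ss)
                        (reorder-good s sss pps)
    reorder-good (pair c d y ∷ s) sss (ps ∷ pps) =
      insertPair-good c d (subst (All (_≤ y)) (sym (pairs≡ (reorder-∼ s))) ps)
                      (reorder-good s sss pps)

    -- A single and a pair cannot both come first: the two orders are decided by
    -- opposite inequalities for the same threshold.
    private
      single≁pair : ∀ {c x s c′ d′ y t} → Good (single c x ∷ s) → Good (pair c′ d′ y ∷ t) →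
                    (single c x ∷ s) ∼ (pair c′ d′ y ∷ t) → ∀ {B : Set} → B
      single≁pair {s = s} {t = t} (single∷ _ _ _) (pair∷ _ _ _) eq
        with singles t | pairs s | singles≡ eq | pairs≡ eq
      single≁pair {s = s} {t = t} (single∷ _ (T≤x ∷ _) _) (pair∷ (x<T ∷ _) _ _) eq
        | _ | _ | refl | refl =
        contradiction (<-≤-trans x<T (subst (λ w → T w _ ≤ _) (∷-injectiveʳ (word≡ eq)) T≤x))
                      (<-irrefl refl)

    good-unique : ∀ {s t} → Good s → Good t → s ∼ t → s ≡ t
    good-unique {[]}             {[]}             _ _  _  = refl
    good-unique {[]}             {single _ _ ∷ _} _ _ eq with () ← word≡ eq
    good-unique {[]}             {pair _ _ _ ∷ _} _ _ eq with () ← word≡ eq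
    good-unique {single _ _ ∷ _} {[]}             _ _ eq with () ← word≡ eq
    good-unique {pair _ _ _ ∷ _} {[]}             _ _ eq with () ← word≡ eq
    good-unique {single c x ∷ s} {single c′ x′ ∷ t} (single∷ _ _ g) (single∷ _ _ h) eq
      with refl , w≡ ← ∷-injective (word≡ eq) | refl , s≡ ← ∷-injective (singles≡ eq) =
      cong (_ ∷_) (good-unique g h
        (record { word≡ = w≡ ; singles≡ = s≡ ; pairs≡ = pairs≡ eq }))
    good-unique {pair c d y ∷ s} {pair c′ d′ y′ ∷ t} (pair∷ _ _ g) (pair∷ _ _ h) eq
      with refl , dw≡ ← ∷-injective (word≡ eq) | refl , p≡ ← ∷-injective (pairs≡ eq)
      with refl , w≡ ← ∷-injective dw≡ =
      cong (_ ∷_) (good-unique g h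
        (record { word≡ = w≡ ; singles≡ = singles≡ eq ; pairs≡ = p≡ }))
    good-unique {single _ _ ∷ _} {pair _ _ _ ∷ _} g h eq = single≁pair g h eq
    good-unique {pair _ _ _ ∷ _} {single _ _ ∷ _} g h eq = single≁pair h g (∼-sym eq)

-- Grouping equal values into pairs

module _ {A : Set} where

  -- A word with a value for each letter, the values decreasing weakly.
  _↘ : List (A × ℕ) → Set
  _↘ = AllPairs (λ a b → proj₂ b ≤ proj₂ a)

  ↘-trans : Transitive {A = A × ℕ} (λ a b → proj₂ b ≤ proj₂ a)
  ↘-trans b≤a c≤b = ≤-trans c≤b b≤a

  flatten : List (Block A) → List (A × ℕ)
  flatten []               = []
  flatten (single c x ∷ s) = (c , x) ∷ flatten s
  flatten (pair c d y ∷ s) = (c , y) ∷ (d , y) ∷ flatten s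

  word-flatten : ∀ s → map proj₁ (flatten s) ≡ word s
  word-flatten []               = refl
  word-flatten (single c x ∷ s) = cong (c ∷_) (word-flatten s)
  word-flatten (pair c d y ∷ s) = cong (λ w → c ∷ d ∷ w) (word-flatten s)

  -- A run of equal values is cut into pairs from its right end, so that a
  -- leftover single precedes the pairs of the same value.
  groupStep : A × ℕ → List (Block A) → List (Block A)
  groupStep (c , x) (single d x′ ∷ s) with x ℕ.≟ x′
  ... | yes _ = pair c d x ∷ s
  ... | no _  = single c x ∷ single d x′ ∷ s
  groupStep (c , x) s = single c x ∷ s

  group : List (A × ℕ) → List (Block A)
  group = foldr groupStep []

  flatten-groupStep : ∀ a s → flatten (groupStep a s) ≡ a ∷ flatten s
  flatten-groupStep (c , x) []               = refl
  flatten-groupStep (c , x) (pair _ _ _ ∷ s) = refl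
  flatten-groupStep (c , x) (single d x′ ∷ s) with x ℕ.≟ x′
  ... | yes refl = refl
  ... | no _     = refl

  flatten-group : ∀ z → flatten (group z) ≡ z
  flatten-group []      = refl
  flatten-group (a ∷ z) =
    trans (flatten-groupStep a (group z)) (cong (a ∷_) (flatten-group z))

  -- The threshold for which good arrangements are those with weakly decreasing
  -- values in which every run of equal values is grouped as by group.
  valueThreshold : List A → ℕ → ℕ
  valueThreshold _ y = y

  valueThreshold-isThreshold : IsThreshold valueThreshold
  valueThreshold-isThreshold = record
    { mono   = λ _ y≤y′ → y≤y′
    ; grow   = λ _ _ _ → ≤-refl
    ; grow≤1 = λ _ _ → n≤1+n
    ; cancel = λ _ _ _ → <⇒≤ }

  module ByValue = Arrangement valueThreshold-isThreshold
  open ByValue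

  All-flatten : ∀ {P : ℕ → Set} s → All P (singles s) → All P (pairs s) →
                All (P ∘ proj₂) (flatten s)
  All-flatten []               _         _         = []
  All-flatten (single _ _ ∷ s) (px ∷ ss) ps        = px ∷ All-flatten s ss ps
  All-flatten (pair _ _ _ ∷ s) ss        (py ∷ ps) = py ∷ py ∷ All-flatten s ss ps

  good⇒flatten↘ : ∀ {s} → Good s → flatten s ↘
  good⇒flatten↘ []                       = []
  good⇒flatten↘ {_ ∷ s} (single∷ ss ps g) =
    All-flatten s (All-map <⇒≤ ss) ps ∷ good⇒flatten↘ g
  good⇒flatten↘ {_ ∷ s} (pair∷ ss ps g)   =
    (≤-refl ∷ rest) ∷ rest ∷ good⇒flatten↘ g
    where rest = All-flatten s (All-map <⇒≤ ss) ps

  group-good : ∀ {z} → z ↘ → Good (group z)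
  group-good []                 = []
  group-good {a ∷ z} (≤a ∷ z↘) =
    step (group z) (group-good z↘) (subst (All _) (sym (flatten-group z)) ≤a)
    where
    step : ∀ {a} s → Good s → All (λ b → proj₂ b ≤ proj₂ a) (flatten s) →
           Good (groupStep a s)
    step []               g _         = fits⇒good tt g
    step (pair _ _ _ ∷ _) g (y≤x ∷ _) = fits⇒good y≤x g
    step {_ , x} (single d x′ ∷ s) g@(single∷ ss ps g′) (x′≤x ∷ _) with x ℕ.≟ x′
    ... | yes refl = pair∷ ss ps g′
    ... | no x≢x′  = fits⇒good (≤∧≢⇒< x′≤x (x≢x′ ∘ sym)) g

  group-flatten : ∀ {s} → Good s → group (flatten s) ≡ s
  group-flatten []                                = refl
  group-flatten {single c x ∷ s} G@(single∷ _ _ g) =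
    trans (cong (groupStep (c , x)) (group-flatten g)) (step s (good⇒fits G))
    where
    step : ∀ s → Fits (single c x) s → groupStep (c , x) s ≡ single c x ∷ s
    step []                _    = refl
    step (pair _ _ _ ∷ _)  _    = refl
    step (single _ x′ ∷ _) x′<x with x ℕ.≟ x′
    ... | yes refl = contradiction x′<x (<-irrefl refl)
    ... | no _     = refl
  group-flatten {pair c d y ∷ s} G@(pair∷ _ _ g) =
    trans (cong (groupStep (c , y) ∘ groupStep (d , y)) (group-flatten g))
      (trans (cong (groupStep (c , y)) (step s (good⇒fits G))) merge)
    where
    step : ∀ s → Fits (pair c d y) s → groupStep (d , y) s ≡ single d y ∷ s
    step []                _    = refl
    step (pair _ _ _ ∷ _)  _    = refl
    step (single _ x′ ∷ _) x′<y with y ℕ.≟ x′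
    ... | yes refl = contradiction x′<y (<-irrefl refl)
    ... | no _     = refl
    merge : groupStep (c , y) (single d y ∷ s) ≡ pair c d y ∷ s
    merge with y ℕ.≟ y
    ... | yes _  = refl
    ... | no y≢y = contradiction refl y≢y

-- The chain condition in normalized form

module _ {m : ℕ} where

  -- The least difference, in 𝒞, between a part of color c and the next one
  -- when the colors of the later parts are w; 0 if there are none.
  link : Fin m → List (Fin m) → ℕ
  link c []      = 0
  link c (d ∷ _) = χ (c Fin.≤? d)

  -- The number of weak ascents of a word.
  energy : List (Fin m) → ℕ
  energy []      = 0
  energy (c ∷ w) = link c w + energy w

  link≤1 : ∀ c w → link c w ≤ 1
  link≤1 c []      = z≤n
  link≤1 c (d ∷ _) = χ≤1 (c Fin.≤? d)

  -- The threshold for ≫. The 1 is due to values starting from 0: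
  -- for values shifted to start from 1 the condition is 2 y + energy w ≤ x.
  chainThreshold : List (Fin m) → ℕ → ℕ
  chainThreshold w y = suc (y + y + energy w)

  chainThreshold-isThreshold : IsThreshold chainThreshold
  chainThreshold-isThreshold = record
    { mono   = λ w y≤y′ → s≤s (+-monoˡ-≤ (energy w) (+-mono-≤ y≤y′ y≤y′))
    ; grow   = λ c w y → s≤s (+-monoʳ-≤ (y + y) (m≤n+m (energy w) (link c w)))
    ; grow≤1 = λ c w y → s≤s (≤-trans (+-monoʳ-≤ (y + y) (+-monoˡ-≤ (energy w) (link≤1 c w)))
                                      (≤-reflexive (+-suc (y + y) (energy w))))
    ; cancel = λ c d w {y} {y′} lt → cancel (link≤1 c (d ∷ w)) (link≤1 d w) lt }
    where
    cancel : ∀ {a b e y y′} → a ≤ 1 → b ≤ 1 →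
             suc (y + y + e) < suc (y′ + y′ + (a + (b + e))) → y ≤ y′
    cancel {a} {b} {e} {y} {y′} a≤1 b≤1 (s≤s lt) = double-cancel-≤
      (+-cancelʳ-≤ (suc e) (y + y) (suc (y′ + y′))
        (≤-trans (≤-reflexive (+-suc (y + y) e))
          (≤-trans lt
            (≤-trans (+-monoʳ-≤ (y′ + y′) (+-mono-≤ a≤1 (+-monoˡ-≤ e b≤1)))
                     (≤-reflexive (+-suc (y′ + y′) (suc e)))))))

  module ByChain = Arrangement chainThreshold-isThreshold
  open ByChain

  part-≡ : ∀ {x y : Part m} → size x ≡ size y → color x ≡ color y → x ≡ y
  part-≡ {part _ _ _} {part _ _ _} refl refl = refl

  -- The sizes of the two primary parts whose sum has the secondary color cd,
  -- when the later parts have the colors w.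
  upper lower : Fin m → Fin m → ℕ → List (Fin m) → ℕ
  upper c d y w = suc (y + energy (c ∷ d ∷ w))
  lower c d y w = suc (y + energy (d ∷ w))

  pair-parity : ∀ c d y w → (upper c d y w + lower c d y w) % 2 ≡ χ (c Fin.≤? d) % 2
  pair-parity c d y w =
    trans (cong (_% 2) (eq (χ (c Fin.≤? d)) y (energy (d ∷ w))))
          ([m+kn]%n≡m%n (χ (c Fin.≤? d)) (lower c d y w) 2)
    where
    eq : ∀ a y e → suc (y + (a + e)) + suc (y + e) ≡ a + suc (y + e) * 2
    eq = solve-∀

  -- The part that a block stands for in front of parts with the colors w.
  partBefore : Block (Fin m) → List (Fin m) → Part m
  partBefore (single c x) w = part (suc (x + energy (c ∷ w))) (primary c) tt
  partBefore (pair c d y) w =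
    part (upper c d y w + lower c d y w) (secondary c d) (pair-parity c d y w)

  chainOf : List (Block (Fin m)) → List (Part m)
  chainOf []      = []
  chainOf (b ∷ s) = partBefore b (word s) ∷ chainOf s

  -- The four cases are those of minGap. In each of them the two sides of the
  -- inequality for ≫ have a large common summand, which depends on the word
  -- alone.
  fits⇔≫ : ∀ b b′ s → Fits b (b′ ∷ s) ⇔ partBefore b (word (b′ ∷ s)) ≫ partBefore b′ (word s)
  fits⇔≫ (single c x) (single d x′) s =
    shift-≤ (suc a + e) (lhs a e x′) (rhs a e x)
    where
    a = χ (c Fin.≤? d)
    e = energy (d ∷ word s)
    lhs : ∀ a e x′ → 1 + a + suc (x′ + e) ≡ suc a + e + suc x′
    lhs = solve-∀
    rhs : ∀ a e x → suc (x + (a + e)) ≡ suc a + e + x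
    rhs = solve-∀
  fits⇔≫ (single p x) (pair q r y) s =
    shift-≤ (suc a + (b + e)) (lhs a b e y) (rhs a b e x)
    where
    a = χ (p Fin.≤? q)
    b = χ (q Fin.≤? r)
    e = energy (r ∷ word s)
    lhs : ∀ a b e y → a + b + (suc (y + (b + e)) + suc (y + e)) ≡ suc a + (b + e) + suc (y + y + (b + e))
    lhs = solve-∀
    rhs : ∀ a b e x → suc (x + (a + (b + e))) ≡ suc a + (b + e) + x
    rhs = solve-∀
  fits⇔≫ (pair p q y) (single r x) s =
    shift-≤ (suc a + (b + e)) (lhs a b e x) (rhs a b e y)
    where
    a = χ (p Fin.≤? q)
    b = χ (q Fin.≤? r)
    e = energy (r ∷ word s)
    lhs : ∀ a b e x → 1 + a + b + suc (x + e) ≡ suc a + (b + e) + suc x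
    lhs = solve-∀
    rhs : ∀ a b e y → suc (y + (a + (b + e))) + suc (y + (b + e)) ≡ suc a + (b + e) + suc (y + y + (b + e))
    rhs = solve-∀
  fits⇔≫ (pair p q y) (pair r t y′) s =
    mk⇔ (λ y′≤y → to (+-mono-≤ y′≤y y′≤y)) (λ ≫ → double-cancel-≤ (m≤n⇒m≤1+n (from ≫)))
    where
    a = χ (p Fin.≤? q)
    b = χ (q Fin.≤? r)
    c = χ (r Fin.≤? t)
    e = energy (t ∷ word s)
    lhs : ∀ a b c e y → a + 2 * b + c + (suc (y + (c + e)) + suc (y + e)) ≡ 2 + a + 2 * (b + c + e) + (y + y)
    lhs = solve-∀
    rhs : ∀ a b c e y → suc (y + (a + (b + (c + e)))) + suc (y + (b + (c + e))) ≡ 2 + a + 2 * (b + c + e) + (y + y)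
    rhs = solve-∀
    open Equivalence (shift-≤ (2 + a + 2 * (b + c + e)) (lhs a b c e y′) (rhs a b c e y))

  good⇒chain : ∀ {s} → Good s → Linked _≫_ (chainOf s)
  good⇒chain {[]}         _ = []
  good⇒chain {_ ∷ []}     _ = [-]
  good⇒chain {b ∷ b′ ∷ s} g =
    Equivalence.to (fits⇔≫ b b′ s) (good⇒fits g) ∷ good⇒chain (good-tail g)

  chainOf-injective : ∀ {s t} → chainOf s ≡ chainOf t → s ≡ t
  chainOf-injective {[]}    {[]}    _  = refl
  chainOf-injective {b ∷ s} {b′ ∷ t} eq with chainOf-injective {s} {t} (∷-injectiveʳ eq)
  ... | refl = cong (_∷ s) (partBefore-injective b b′ (∷-injectiveˡ eq))
    where
    partBefore-injective : ∀ b b′ {w} → partBefore b w ≡ partBefore b′ w → b ≡ b′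
    partBefore-injective (single c x) (single d x′) {w} eq with cong color eq
    ... | refl = cong (single c) (+-cancelʳ-≡ (energy (c ∷ w)) x x′ (suc-injective (cong size eq)))
    partBefore-injective (single _ _) (pair _ _ _) eq with () ← cong color eq
    partBefore-injective (pair _ _ _) (single _ _) eq with () ← cong color eq
    partBefore-injective (pair c d y) (pair c′ d′ y′) {w} eq with cong color eq
    ... | refl = cong (pair c d) (≤-antisym (half (≤-reflexive (cong size eq)))
                                            (half (≤-reflexive (sym (cong size eq)))))
      where
      a = χ (c Fin.≤? d)
      e = energy (d ∷ w)
      eq₂ : ∀ a e y → suc (y + (a + e)) + suc (y + e) ≡ 2 + a + 2 * e + (y + y)
      eq₂ = solve-∀
      half : ∀ {y y′} → upper c d y w + lower c d y w ≤ upper c d y′ w + lower c d y′ w → y ≤ y′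
      half {y} {y′} le = double-cancel-≤ (m≤n⇒m≤1+n
        (Equivalence.from (shift-≤ (2 + a + 2 * e) (eq₂ a e y) (eq₂ a e y′)) le))

module _ {m : ℕ} where
  open ByChain {m}

  -- Below a leading single there is room for every later link. Therefore a
  -- pair whose doubled value only exceeds that single can precede it.
  energy≤value : ∀ {c x s} → Good (single c x ∷ s) → energy (c ∷ word s) ≤ x
  energy≤value {s = []} _ = z≤n
  energy≤value {c} {x} {single d x′ ∷ s} (single∷ (x′<x ∷ _) _ g) =
    ≤-trans (+-mono-≤ (link≤1 c (d ∷ word s)) (energy≤value g)) x′<x
  energy≤value {c} {x} {pair d e y ∷ s} (single∷ _ (T≤x ∷ _) _) =
    ≤-trans (+-mono-≤ (link≤1 c (d ∷ e ∷ word s)) (m≤n+m _ (y + y))) T≤x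

  -- The part is not of size 1 with a secondary color.
  No1 : Part m → Set
  No1 x = ¬ (IsSecondary (color x) × size x ≡ 1)

  -- x may be put in front of chainOf s.
  Leads : Part m → List (Block (Fin m)) → Set
  Leads x []      = ⊤
  Leads x (b ∷ s) = x ≫ partBefore b (word s)

  -- In a chain, the normalized value of a part of primary color is not
  -- negative.
  primary-bound : ∀ {c k} .{{_ : NonZero k}} s → Leads (part k (primary c) tt) s → energy (c ∷ word s) < k
  primary-bound {c} {k} [] _ = >-nonZero⁻¹ k
  primary-bound {c} (single d x ∷ s) lead =
    ≤-trans (s≤s (+-monoʳ-≤ (χ (c Fin.≤? d)) (≤-trans (m≤n+m _ x) (n≤1+n _)))) lead
  primary-bound {c} {k} (pair d e y ∷ s) lead = ≤-trans
    (≤-trans (≤-reflexive (eq (χ (c Fin.≤? d)) (χ (d Fin.≤? e)) (energy (e ∷ word s))))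
      (+-monoʳ-≤ (χ (c Fin.≤? d) + χ (d Fin.≤? e)) {1 + energy (e ∷ word s)}
         (≤-trans (s≤s (m≤n+m _ y)) (m≤n+m _ (upper d e y (word s)))))) lead
    where
    eq : ∀ a b e → suc (a + (b + e)) ≡ a + b + (1 + e)
    eq = solve-∀

  -- The same for a part of secondary color cd, where h is the size of the
  -- smaller half. For the last part this is the exclusion of size 1; in front
  -- of a single it relies on the energy bound for that single.
  secondary-bound : ∀ {c d h k} .{{_ : NonZero k}} .{ok : MayColor (secondary c d) k} s → Good s →
                    k ≡ χ (c Fin.≤? d) + h * 2 → No1 (part k (secondary c d) ok) →
                    Leads (part k (secondary c d) ok) s → energy (d ∷ word s) < h
  secondary-bound {h = suc h} [] _ _ _ _ = s≤s z≤n
  secondary-bound {c} {d} {zero} {k} [] _ k≡ k≢1 _ = contradiction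
    ((_ , _ , refl) , ≤-antisym (≤-trans (≤-reflexive (trans k≡ (+-identityʳ _))) (χ≤1 (c Fin.≤? d)))
                                (>-nonZero⁻¹ k)) k≢1
  secondary-bound {c} {d} {h} (single e x ∷ s) g refl _ lead = double-cancel-<
    (≤-trans (s≤s (≤-trans (+-mono-≤ (+-mono-≤ (link≤1 d (e ∷ word s)) E≤x) ≤-refl)
                           (≤-reflexive (arrange x b E))))
      (Equivalence.from (shift-≤ a (lhs a b x E) (rhs a h)) lead))
    where
    a = χ (c Fin.≤? d)
    b = χ (d Fin.≤? e)
    E = energy (e ∷ word s)
    E≤x = energy≤value g
    arrange : ∀ x b E → 1 + x + (b + E) ≡ 1 + b + x + E
    arrange = solve-∀
    lhs : ∀ a b x E → 1 + a + b + suc (x + E) ≡ a + (1 + (1 + b + x + E))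
    lhs = solve-∀
    rhs : ∀ a h → a + h * 2 ≡ a + (h + h)
    rhs = solve-∀
  secondary-bound {c} {d} {h} (pair e f y ∷ s) _ refl _ lead = double-cancel-<
    (≤-trans (m≤n+m _ (1 + 2 * y))
      (Equivalence.from (shift-≤ a (lhs a b c′ y E) (rhs a h)) lead))
    where
    a = χ (c Fin.≤? d)
    b = χ (d Fin.≤? e)
    c′ = χ (e Fin.≤? f)
    E = energy (f ∷ word s)
    lhs : ∀ a b c y E → a + 2 * b + c + (suc (y + (c + E)) + suc (y + E)) ≡ a + (1 + 2 * y + suc ((b + (c + E)) + (b + (c + E))))
    lhs = solve-∀
    rhs : ∀ a h → a + h * 2 ≡ a + (h + h)
    rhs = solve-∀

  leads⇒block : ∀ x s → Good s → No1 x → Leads x s → ∃ λ b → partBefore b (word s) ≡ x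
  leads⇒block (part k (primary c) _) s _ _ lead with below (primary-bound s lead)
  ... | y , refl = single c y , refl
  leads⇒block (part k (secondary c d) ok) s g k≢1 lead
    with k≡ ← even-part (c Fin.≤? d) (recompute (k % 2 ℕ.≟ χ (c Fin.≤? d) % 2) ok)
    with below (secondary-bound {h = k / 2} s g k≡ k≢1 lead)
  ... | y , h≡ = pair c d y , part-≡ (sym (trans k≡ (trans (cong (λ h → a + h * 2) h≡) (eq a y E)))) refl
    where
    a = χ (c Fin.≤? d)
    E = energy (d ∷ word s)
    eq : ∀ a y E → a + suc (y + E) * 2 ≡ suc (y + (a + E)) + suc (y + E)
    eq = solve-∀

  chain⇒good : ∀ l → Linked _≫_ l → All No1 l → ∃ λ s → Good s × chainOf s ≡ l
  chain⇒good []      _  _          = [] , [] , refl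
  chain⇒good (x ∷ l) ch (no1 ∷ no1s) with chain⇒good l (tail ch) no1s
    where
    tail : ∀ {x l} → Linked _≫_ (x ∷ l) → Linked {A = Part m} _≫_ l
    tail [-]      = []
    tail (_ ∷ ch) = ch
  ... | s , g , refl with leads⇒block x s g no1 (leads s ch)
    where
    leads : ∀ s → Linked _≫_ (x ∷ chainOf s) → Leads x s
    leads []      _       = tt
    leads (_ ∷ _) (≫ ∷ _) = ≫
  ... | b , refl = b ∷ s , fits⇒good (fits s ch) g , refl
    where
    fits : ∀ s → Linked _≫_ (partBefore b (word s) ∷ chainOf s) → Fits b s
    fits []       _       = tt
    fits (b′ ∷ s) (≫ ∷ _) = Equivalence.from (fits⇔≫ b b′ s) ≫

-- Sorting by a strict order

module _ {A : Set} {R : Rel A 0ℓ} where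

  sorted-unique : Asymmetric R → ∀ {xs ys} → AllPairs R xs → AllPairs R ys → xs ↭ ys → xs ≡ ys
  sorted-unique asym []       []       _ = refl
  sorted-unique asym []       (_ ∷ _)  p = contradiction (↭-sym p) ¬x∷xs↭[]
  sorted-unique asym (_ ∷ _)  []       p = contradiction p ¬x∷xs↭[]
  sorted-unique asym (x> ∷ xs↘) (y> ∷ ys↘) p
    with ∈-resp-↭ p (here refl) | ∈-resp-↭ (↭-sym p) (here refl)
  ... | here refl  | _          = cong (_ ∷_) (sorted-unique asym xs↘ ys↘ (drop-∷ p))
  ... | there _    | here refl  = cong (_ ∷_) (sorted-unique asym xs↘ ys↘ (drop-∷ p))
  ... | there x∈ys | there y∈xs = contradiction (All.lookup x> y∈xs) (asym (All.lookup y> x∈ys))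

  sorted-insert : Transitive R → ∀ x {ys} → All (λ y → R x y ⊎ R y x) ys → AllPairs R ys →
                  ∃ λ zs → x ∷ ys ↭ zs × AllPairs R zs
  sorted-insert _     x [] [] = _ , ↭-refl , [] ∷ []
  sorted-insert R-trans x {y ∷ ys} (inj₁ Rxy ∷ _) (y> ∷ ys↘) =
    _ , ↭-refl , (Rxy ∷ All-map (R-trans Rxy) y>) ∷ y> ∷ ys↘
  sorted-insert R-trans x {y ∷ ys} (inj₂ Ryx ∷ cmp) (y> ∷ ys↘)
    with zs , p , zs↘ ← sorted-insert R-trans x cmp ys↘ =
    y ∷ zs , ↭-trans (swap x y ↭-refl) (prep y p) , All-resp-↭ p (Ryx ∷ y>) ∷ zs↘

  -- Pairwise comparability replaces totality of R.
  sort : Transitive R → ∀ {xs} → AllPairs (λ x y → R x y ⊎ R y x) xs →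
         ∃ λ ys → xs ↭ ys × AllPairs R ys
  sort R-trans [] = [] , ↭-refl , []
  sort R-trans {x ∷ xs} (cmp ∷ cmps)
    with ys , p , ys↘ ← sort R-trans cmps
    with zs , q , zs↘ ← sorted-insert R-trans x (All-resp-↭ p cmp) ys↘ =
    zs , ↭-trans (prep x p) q , zs↘

-- The order on parts

module _ {m : ℕ} where

  firstColor : Color m → Fin m
  firstColor (primary p)     = p
  firstColor (secondary p _) = p

  -- Larger size first, then larger first color. Both ≫ and the order in which
  -- primary parts are listed are contained in this strict order.
  infix 4 _⊐_
  _⊐_ : Part m → Part m → Set
  x ⊐ y = size y < size x ⊎
          (size x ≡ size y × firstColor (color y) Fin.< firstColor (color x))

  ⊐-trans : Transitive _⊐_
  ⊐-trans (inj₁ p)          (inj₁ q)          = inj₁ (<-trans q p)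
  ⊐-trans {x} (inj₁ p)      (inj₂ (q≡ , _))   = inj₁ (subst (_< size x) q≡ p)
  ⊐-trans {k = z} (inj₂ (p≡ , _)) (inj₁ q)    = inj₁ (subst (size z <_) (sym p≡) q)
  ⊐-trans (inj₂ (p≡ , p))   (inj₂ (q≡ , q))   = inj₂ (trans p≡ q≡ , <-trans q p)

  ⊐-asym : Asymmetric _⊐_
  ⊐-asym (inj₁ p)        (inj₁ q)        = <-asym p q
  ⊐-asym (inj₁ p)        (inj₂ (q≡ , _)) = <-irrefl q≡ p
  ⊐-asym (inj₂ (p≡ , _)) (inj₁ q)        = <-irrefl p≡ q
  ⊐-asym (inj₂ (_ , p))  (inj₂ (_ , q))  = <-asym p q

  -- Parts of equal size can follow each other in a chain only if the gap is 0;
  -- then the indicators in it vanish, which makes the first color decrease.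
  χ≡0⇒> : ∀ {p q : Fin m} → χ (p Fin.≤? q) ≡ 0 → q Fin.< p
  χ≡0⇒> {p} {q} χ≡0 = ≰⇒> λ p≤q → contradiction (trans (sym (χ-yes (p Fin.≤? q) p≤q)) χ≡0) λ ()

  minGap≡0⇒> : ∀ (c d : Color m) → minGap c d ≡ 0 → firstColor d Fin.< firstColor c
  minGap≡0⇒> (primary p) (secondary q r) eq = χ≡0⇒> (m+n≡0⇒m≡0 (χ (p Fin.≤? q)) eq)
  minGap≡0⇒> (secondary p q) (secondary r t) eq = <-trans
    (χ≡0⇒> (m+n≡0⇒m≡0 (χ (q Fin.≤? r)) (m+n≡0⇒n≡0 (χ (p Fin.≤? q)) eq′)))
    (χ≡0⇒> (m+n≡0⇒m≡0 (χ (p Fin.≤? q)) eq′))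
    where eq′ = m+n≡0⇒m≡0 (χ (p Fin.≤? q) + 2 * χ (q Fin.≤? r)) eq

  ≫⇒⊐ : ∀ {x y : Part m} → x ≫ y → x ⊐ y
  ≫⇒⊐ {x} {y} x≫y with m≤n⇒m<n∨m≡n (≤-trans (m≤n+m (size y) _) x≫y)
  ... | inj₁ y<x = inj₁ y<x
  ... | inj₂ y≡x = inj₂ (sym y≡x , minGap≡0⇒> (color x) (color y) (n≤0⇒n≡0
        (+-cancelʳ-≤ (size y) _ 0 (≤-trans x≫y (≤-reflexive (sym y≡x))))))

  -- On primary parts ⊐ is the condition that 𝒟 has with the gap lowered by 1.
  ⊐⇔gap : ∀ {x y : Part m} {p q} → color x ≡ primary p → color y ≡ primary q →
          x ⊐ y ⇔ χ (p Fin.≤? q) + size y ≤ size x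
  ⊐⇔gap {x} {y} {p} {q} refl refl = mk⇔ to from
    where
    to : x ⊐ y → χ (p Fin.≤? q) + size y ≤ size x
    to (inj₁ y<x)         = ≤-trans (+-monoˡ-≤ (size y) (χ≤1 (p Fin.≤? q))) y<x
    to (inj₂ (x≡y , q<p)) = ≤-reflexive (trans (cong (_+ size y) (χ-no (p Fin.≤? q) (<⇒≱ q<p))) (sym x≡y))
    from : χ (p Fin.≤? q) + size y ≤ size x → x ⊐ y
    from le with m≤n⇒m<n∨m≡n (≤-trans (m≤n+m (size y) _) le)
    ... | inj₁ y<x = inj₁ y<x
    ... | inj₂ y≡x = inj₂ (sym y≡x , χ≡0⇒> (n≤0⇒n≡0
          (+-cancelʳ-≤ (size y) _ 0 (≤-trans le (≤-reflexive (sym y≡x))))))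

  -- Partitions into primary parts in normalized form

  -- The primary parts with the given colors and normalized values.
  place : List (Fin m × ℕ) → List (Part m)
  place []            = []
  place ((c , x) ∷ z) = part (suc (x + energy (c ∷ map proj₁ z))) (primary c) tt ∷ place z

  place-primary : ∀ z → All (IsPrimary ∘ color) (place z)
  place-primary []            = []
  place-primary ((c , _) ∷ z) = (c , refl) ∷ place-primary z

  place-injective : ∀ {z z′} → place z ≡ place z′ → z ≡ z′
  place-injective {[]}          {[]}            _  = refl
  place-injective {(c , x) ∷ z} {(d , x′) ∷ z′} eq
    with refl ← place-injective {z} {z′} (∷-injectiveʳ eq) | refl ← cong color (∷-injectiveˡ eq) =
    cong (λ x → (c , x) ∷ z) (+-cancelʳ-≡ (energy (c ∷ map proj₁ z)) x x′
      (suc-injective (cong size (∷-injectiveˡ eq))))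

  private
    ≤⇔gap : ∀ {x x′} a e → x′ ≤ x ⇔ a + suc (x′ + e) ≤ suc (x + (a + e))
    ≤⇔gap {x} {x′} a e = shift-≤ (suc a + e) (lhs a e x′) (rhs a e x)
      where
      lhs : ∀ a e x′ → a + suc (x′ + e) ≡ suc a + e + x′
      lhs = solve-∀
      rhs : ∀ a e x → suc (x + (a + e)) ≡ suc a + e + x
      rhs = solve-∀

  place-sorted : ∀ {z} → z ↘ → AllPairs _⊐_ (place z)
  place-sorted z↘ = Linked⇒AllPairs (λ {x} {y} {z} → ⊐-trans {x} {y} {z}) (linked (AllPairs⇒Linked z↘))
    where
    linked : ∀ {z} → Linked (λ a b → proj₂ b ≤ proj₂ a) z → Linked _⊐_ (place z)
    linked []  = []
    linked [-] = [-]
    linked {(c , x) ∷ (d , x′) ∷ z} (x′≤x ∷ l) =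
      Equivalence.from (⊐⇔gap refl refl)
        (Equivalence.to (≤⇔gap (χ (c Fin.≤? d)) (energy (d ∷ map proj₁ z))) x′≤x)
      ∷ linked l

  linked⇒place : ∀ {l} → All (IsPrimary ∘ color) l → Linked _⊐_ l →
           ∃ λ z → Linked (λ a b → proj₂ b ≤ proj₂ a) z × place z ≡ l
  linked⇒place [] [] = [] , [] , refl
  linked⇒place {part k _ {{k≢0}} _ ∷ []} ((c , refl) ∷ []) [-]
    with x , k≡ ← below (>-nonZero⁻¹ k {{k≢0}}) =
    (c , x) ∷ [] , [-] , cong (_∷ []) (part-≡ (sym k≡) refl)
  linked⇒place {x₀@(part k _ _) ∷ y₀ ∷ _} ((c , refl) ∷ ps) (⊐y ∷ l↘) with linked⇒place ps l↘
  ... | (d , x′) ∷ z , z↘ , refl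
    with gap ← Equivalence.to (⊐⇔gap {x₀} {y₀} refl refl) ⊐y
    with below (≤-trans (≤-trans (s≤s (+-monoʳ-≤ (χ (c Fin.≤? d)) (m≤n+m (energy (d ∷ map proj₁ z)) x′)))
                                 (≤-reflexive (sym (+-suc (χ (c Fin.≤? d)) _)))) gap)
  ... | x , refl = (c , x) ∷ (d , x′) ∷ z ,
                   Equivalence.from (≤⇔gap (χ (c Fin.≤? d)) (energy (d ∷ map proj₁ z))) gap ∷ z↘ ,
                   refl

  sorted⇒place : ∀ {l} → All (IsPrimary ∘ color) l → AllPairs _⊐_ l → ∃ λ z → z ↘ × place z ≡ l
  sorted⇒place primaries l↘ with z , z↘ , eq ← linked⇒place primaries (AllPairs⇒Linked l↘) =
    z , Linked⇒AllPairs (λ {a} {b} {c} → ↘-trans {i = a} {b} {c}) z↘ , eq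

  -- Weights and color counts

  -- The number of which a list of parts is a partition.
  weight : List (Part m) → ℕ
  weight l = sum (map size l)

  -- The sum of all that normalization takes away from the parts.
  potential : List (Fin m) → ℕ
  potential []      = 0
  potential (c ∷ w) = suc (energy (c ∷ w)) + potential w

  weight-chainOf : ∀ s → weight (chainOf s) ≡ sum (singles s) + 2 * sum (pairs s) + potential (word s)
  weight-chainOf [] = refl
  weight-chainOf (single c x ∷ s) =
    trans (cong (suc (x + energy (c ∷ word s)) +_) (weight-chainOf s))
            (eq x (energy (c ∷ word s)) (sum (singles s)) (sum (pairs s)) (potential (word s)))
    where
    eq : ∀ x e S P p → suc (x + e) + (S + 2 * P + p) ≡ x + S + 2 * P + (suc e + p)
    eq = solve-∀
  weight-chainOf (pair c d y ∷ s) =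
    trans (cong (upper c d y (word s) + lower c d y (word s) +_) (weight-chainOf s))
            (eq y (energy (c ∷ d ∷ word s)) (energy (d ∷ word s))
                (sum (singles s)) (sum (pairs s)) (potential (word s)))
    where
    eq : ∀ y e f S P p → suc (y + e) + suc (y + f) + (S + 2 * P + p) ≡ S + 2 * (y + P) + (suc e + (suc f + p))
    eq = solve-∀

  weight-∼ : ∀ {s t} → s ∼ t → weight (chainOf s) ≡ weight (chainOf t)
  weight-∼ {s} {t} s∼t =
    trans (weight-chainOf s) (trans
      (cong₂ _+_ (cong₂ (λ S P → sum S + 2 * sum P) (singles≡ s∼t) (pairs≡ s∼t))
                 (cong potential (word≡ s∼t)))
      (sym (weight-chainOf t)))

  weight-flatten : ∀ s → weight (place (flatten s)) ≡ weight (chainOf s)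
  weight-flatten [] = refl
  weight-flatten (single c x ∷ s) rewrite word-flatten s =
    cong (suc (x + energy (c ∷ word s)) +_) (weight-flatten s)
  weight-flatten (pair c d y ∷ s) rewrite word-flatten s =
    trans (cong (λ k → upper c d y (word s) + (lower c d y (word s) + k)) (weight-flatten s))
            (sym (+-assoc (upper c d y (word s)) _ _))

  occurrences : Fin m → List (Fin m) → ℕ
  occurrences i []      = 0
  occurrences i (c ∷ w) = χ (c Fin.≟ i) + occurrences i w

  #colored-∷ : ∀ {P : Pred (Color m) 0ℓ} (P? : Decidable P) x l →
               #colored P? (x ∷ l) ≡ χ (P? (color x)) + #colored P? l
  #colored-∷ P? x l with P? (color x)
  ... | yes _ = refl
  ... | no _  = refl

  #colored-place : ∀ i z → #colored (_≟ primary i) (place z) ≡ occurrences i (map proj₁ z)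
  #colored-place i []            = refl
  #colored-place i ((c , x) ∷ z) = trans (#colored-∷ (_≟ primary i) (part (suc (x + energy (c ∷ map proj₁ z))) (primary c) tt) (place z))
    (cong₂ _+_ (χ-cong {A? = primary c ≟ primary i} {c Fin.≟ i} (mk⇔ (λ { refl → refl }) (cong primary))) (#colored-place i z))

  -- The number of times that the color c counts for i in 𝒟.
  multiplicity : Fin m → Color m → ℕ
  multiplicity i c = χ (involvesOnce? i c) + 2 * χ (c ≟ secondary i i)

  multiplicity-primary : ∀ i c → multiplicity i (primary c) ≡ χ (c Fin.≟ i)
  multiplicity-primary i c = trans (+-identityʳ _)
    (χ-cong {A? = involvesOnce? i (primary c)} {c Fin.≟ i} (mk⇔ to (λ { refl → inj₁ refl })))
    where
    to : InvolvesOnce i (primary c) → c ≡ i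
    to (inj₁ refl)               = refl
    to (inj₂ (_ , _ , inj₁ ()))
    to (inj₂ (_ , _ , inj₂ ()))

  multiplicity-secondary : ∀ i c d → multiplicity i (secondary c d) ≡ χ (c Fin.≟ i) + χ (d Fin.≟ i)
  multiplicity-secondary i c d = go (c Fin.≟ i) (d Fin.≟ i)
    where
    go : (c? : Dec (c ≡ i)) (d? : Dec (d ≡ i)) → multiplicity i (secondary c d) ≡ χ c? + χ d?
    go (yes refl) (yes refl) = cong₂ (λ a b → a + 2 * b)
      (χ-no (involvesOnce? i (secondary i i))
        λ { (inj₂ (_ , j≢i , inj₁ refl)) → j≢i refl ; (inj₂ (_ , j≢i , inj₂ refl)) → j≢i refl })
      (χ-yes (secondary i i ≟ secondary i i) refl)
    go (yes refl) (no d≢i) = cong₂ (λ a b → a + 2 * b)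
      (χ-yes (involvesOnce? i (secondary i d)) (inj₂ (d , d≢i , inj₁ refl)))
      (χ-no (secondary i d ≟ secondary i i) λ { refl → d≢i refl })
    go (no c≢i) (yes refl) = cong₂ (λ a b → a + 2 * b)
      (χ-yes (involvesOnce? i (secondary c i)) (inj₂ (c , c≢i , inj₂ refl)))
      (χ-no (secondary c i ≟ secondary i i) λ { refl → c≢i refl })
    go (no c≢i) (no d≢i) = cong₂ (λ a b → a + 2 * b)
      (χ-no (involvesOnce? i (secondary c d))
        λ { (inj₂ (_ , _ , inj₁ refl)) → c≢i refl ; (inj₂ (_ , _ , inj₂ refl)) → d≢i refl })
      (χ-no (secondary c d ≟ secondary i i) λ { refl → c≢i refl })

  -- Every chain has the color counts of its word, a secondary color counting as
  -- its two letters.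
  #colored-chainOf : ∀ i s → #colored (involvesOnce? i) (chainOf s) + 2 * #colored (_≟ secondary i i) (chainOf s)
                           ≡ occurrences i (word s)
  #colored-chainOf i [] = refl
  #colored-chainOf i (b ∷ s) = trans
    (cong₂ (λ a b → a + 2 * b) (#colored-∷ (involvesOnce? i) (partBefore b (word s)) (chainOf s))
                               (#colored-∷ (_≟ secondary i i) (partBefore b (word s)) (chainOf s)))
    (trans (eq (χ (involvesOnce? i (color (partBefore b (word s))))) _ (χ (color (partBefore b (word s)) ≟ secondary i i)) _)
      (trans (cong (multiplicity i (color (partBefore b (word s))) +_) (#colored-chainOf i s)) (step b)))
    where
    eq : ∀ a A b B → a + A + 2 * (b + B) ≡ a + 2 * b + (A + 2 * B)
    eq = solve-∀
    step : ∀ b → multiplicity i (color (partBefore b (word s))) + occurrences i (word s) ≡ occurrences i (word (b ∷ s))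
    step (single c _) = cong (_+ occurrences i (word s)) (multiplicity-primary i c)
    step (pair c d _) = trans (cong (_+ occurrences i (word s)) (multiplicity-secondary i c d))
                                (+-assoc (χ (c Fin.≟ i)) _ _)

-- The bijection on normalized sequences

module _ {m : ℕ} where

  -- The chain, in blocks, that corresponds to a normalized partition into
  -- primary parts.
  arrange : List (Fin m × ℕ) → List (Block (Fin m))
  arrange z = ByChain.reorder (group z)

  arrange-∼ : ∀ z → arrange z ∼ group z
  arrange-∼ z = ByChain.reorder-∼ (group z)

  arrange-good : ∀ {z} → z ↘ → ByChain.Good (arrange z)
  arrange-good {z} z↘ = ByChain.reorder-good (group z) (ByValue.good⇒singles↘ g) (ByValue.good⇒pairs↘ g)
    where g = group-good z↘

  arrange-injective : ∀ {z z′} → z ↘ → z′ ↘ → arrange z ≡ arrange z′ → z ≡ z′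
  arrange-injective {z} {z′} z↘ z′↘ eq =
    trans (sym (flatten-group z)) (trans (cong flatten same) (flatten-group z′))
    where
    same : group z ≡ group z′
    same = ByValue.good-unique (group-good z↘) (group-good z′↘)
      (∼-trans (∼-sym (arrange-∼ z)) (subst (_∼ group z′) (sym eq) (arrange-∼ z′)))

  arrange-surjective : ∀ {s} → ByChain.Good s → ∃ λ z → z ↘ × arrange z ≡ s
  arrange-surjective {s} g = flatten t , good⇒flatten↘ t-good ,
    trans (cong ByChain.reorder (group-flatten t-good))
          (ByChain.good-unique
            (ByChain.reorder-good t (ByValue.good⇒singles↘ t-good) (ByValue.good⇒pairs↘ t-good)) g
            (∼-trans (ByChain.reorder-∼ t) (ByValue.reorder-∼ s)))
    where
    t = ByValue.reorder s
    t-good = ByValue.reorder-good s (ByChain.good⇒singles↘ g) (ByChain.good⇒pairs↘ g)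

  word-arrange : ∀ z → word (arrange z) ≡ map proj₁ z
  word-arrange z = trans (word≡ (arrange-∼ z))
    (trans (sym (word-flatten (group z))) (cong (map proj₁) (flatten-group z)))

  weight-arrange : ∀ z → weight (chainOf (arrange z)) ≡ weight (place z)
  weight-arrange z = trans (weight-∼ (arrange-∼ z))
    (trans (sym (weight-flatten (group z))) (cong (weight ∘ place) (flatten-group z)))

  chainOf-no1 : ∀ s → All (No1 {m}) (chainOf s)
  chainOf-no1 []               = []
  chainOf-no1 (single _ _ ∷ s) = (λ { ((_ , _ , ()) , _) }) ∷ chainOf-no1 s
  chainOf-no1 (pair c d y ∷ s) =
    (λ { (_ , size≡1) → contradiction (trans (sym (+-suc _ _)) (suc-injective size≡1)) λ () }) ∷ chainOf-no1 s

-- Enumeration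

module _ {A : Set} where

  lookup-injective : ∀ {xs : List A} → Unique xs → ∀ i j → lookup xs i ≡ lookup xs j → i ≡ j
  lookup-injective (_ ∷ _)   Fin.zero    Fin.zero    _  = refl
  lookup-injective (x∉ ∷ _)  Fin.zero    (Fin.suc j) eq = contradiction eq (All.lookup x∉ (∈-lookup j))
  lookup-injective (x∉ ∷ _)  (Fin.suc i) Fin.zero    eq = contradiction (sym eq) (All.lookup x∉ (∈-lookup i))
  lookup-injective (_ ∷ xs!) (Fin.suc i) (Fin.suc j) eq = cong Fin.suc (lookup-injective xs! i j eq)

  -- The lists of length at most k with entries from as.
  listsUpTo : ℕ → List A → List (List A)
  listsUpTo zero    as = [] ∷ []
  listsUpTo (suc k) as = [] ∷ cartesianProductWith _∷_ as (listsUpTo k as)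

  ∈-listsUpTo : ∀ {k as xs} → length xs ≤ k → All (_∈ as) xs → xs ∈ listsUpTo k as
  ∈-listsUpTo {zero}  {xs = []} _ _ = here refl
  ∈-listsUpTo {suc k} {xs = []} _ _ = here refl
  ∈-listsUpTo {suc k} {xs = _ ∷ _} (s≤s len) (x∈ ∷ xs∈) =
    there (∈-cartesianProductWith⁺ _∷_ x∈ (∈-listsUpTo len xs∈))

  listsUpTo-unique : ∀ k {as} → Unique as → Unique (listsUpTo k as)
  listsUpTo-unique zero    _   = [] ∷ []
  listsUpTo-unique (suc k) {as} as! =
    Allₚ.cartesianProductWith⁺ (setoid A) (setoid (List A)) _∷_ as (listsUpTo k as) (λ _ _ ())
    ∷ Uniqueₚ.cartesianProductWith⁺ _∷_ ∷-injective as! (listsUpTo-unique k as!)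

module _ {m n : ℕ} {B : Set} where

  -- A multiset has at most one order that is decreasing for ⊐. So the
  -- partitions with property P are counted by a duplicate-free list of codes as
  -- soon as f assigns decreasing lists with property P to the codes, injectively
  -- and reaching every such partition up to order.
  hasCardinality : {P : Pred (Partition m n) 0ℓ} {V : Pred B 0ℓ}
    (bs : List B) → Unique bs → (∀ {b} → b ∈ bs → V b) → (∀ {b} → V b → b ∈ bs) →
    (f : B → List (Part m)) →
    (∀ {b} → V b → Σ (weight (f b) ≡ n) λ eq → P (partition (f b) eq)) →
    (∀ {b} → V b → AllPairs _⊐_ (f b)) →
    (∀ {b b′} → V b → V b′ → f b ≡ f b′ → b ≡ b′) →
    (∀ π → P π → ∃ λ b → V b × f b ↭ parts π) →
    HasCardinality (Partitions P) (length bs)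
  hasCardinality {P} {V} bs bs! sound complete f valid sorted injective onto = record
    { to        = element
    ; cong      = λ { refl → ↭-refl }
    ; bijective =
        (λ {i} {j} fi↭fj → lookup-injective bs! i j
          (injective (at i) (at j) (sorted-unique (λ {x} {y} → ⊐-asym {x = x} {y}) (sorted (at i)) (sorted (at j)) fi↭fj)))
      , (λ (π , Pπ) → let b , Vb , fb↭π = onto π Pπ in
           index (complete Vb) ,
           λ { refl → subst (λ b → f b ↭ parts π) (lookup-index (complete Vb)) fb↭π })
    }
    where
    at : ∀ i → V (lookup bs i)
    at i = sound (∈-lookup i)
    element : Fin (length bs) → Σ (Partition m n) P
    element i = partition (f (lookup bs i)) (proj₁ (valid (at i))) , proj₂ (valid (at i))

-- The two sets of partitions

module _ {m : ℕ} (u : Fin m → ℕ) (n : ℕ) where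

  -- The normalized form of an element of 𝒞 u n.
  record Valid (z : List (Fin m × ℕ)) : Set where
    constructor valid
    field
      decreasing : z ↘
      counts     : ∀ i → occurrences i (map proj₁ z) ≡ u i
      total      : weight (place z) ≡ n

  open Valid

  valid? : Decidable Valid
  valid? z = map′ (λ (d , c , t) → valid d c t) (λ v → decreasing v , counts v , total v)
    (allPairs? (λ a b → proj₂ b ≤? proj₂ a) z ×-dec
     Finₚ.all? (λ i → occurrences i (map proj₁ z) ℕ.≟ u i) ×-dec
     weight (place z) ℕ.≟ n)

  -- Every value is less than the size of its part, hence less than n.
  letters : List (Fin m × ℕ)
  letters = cartesianProduct (allFin m) (upTo n)

  valids : List (List (Fin m × ℕ))
  valids = filter valid? (listsUpTo n letters)

  valids-unique : Unique valids
  valids-unique = Uniqueₚ.filter⁺ valid?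
    (listsUpTo-unique n (Uniqueₚ.cartesianProduct⁺ (Uniqueₚ.allFin⁺ m) (Uniqueₚ.upTo⁺ n)))

  ∈-valids : ∀ {z} → Valid z → z ∈ valids
  ∈-valids {z} v = ∈-filter⁺ valid? (∈-listsUpTo (subst (length z ≤_) (total v) (length≤ z))
    (All-map (λ {a} <w → ∈-cartesianProduct⁺ (∈-allFin (proj₁ a)) (∈-upTo⁺ (subst (proj₂ a <_) (total v) <w)))
             (values< z))) v
    where
    length≤ : ∀ z → length z ≤ weight (place z)
    length≤ []            = z≤n
    length≤ ((c , x) ∷ z) = s≤s (≤-trans (length≤ z) (m≤n+m _ (x + energy (c ∷ map proj₁ z))))
    values< : ∀ z → All (λ a → proj₂ a < weight (place z)) z
    values< []            = []
    values< ((c , x) ∷ z) =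
      s≤s (≤-trans (m≤m+n x _) (m≤m+n _ (weight (place z)))) ∷
      All-map (λ <w → <-≤-trans <w (m≤n+m _ (suc (x + energy (c ∷ map proj₁ z))))) (values< z)

  ∈-valids⁻ : ∀ {z} → z ∈ valids → Valid z
  ∈-valids⁻ z∈ = proj₂ (∈-filter⁻ valid? {xs = listsUpTo n letters} z∈)

  place-InC : ∀ {z} → Valid z → Σ (weight (place z) ≡ n) λ eq → InC u (partition (place z) eq)
  place-InC {z} v = total v , record
    { allPrimary = place-primary z
    ; counts     = λ i → trans (#colored-place i z) (counts v i)
    ; distinct   = AllPairs.map (λ { (inj₁ y<x) _ → >⇒≢ y<x
                                   ; (inj₂ (_ , q<p)) c≡d _ → <-irrefl (cong (Fin.toℕ ∘ firstColor) (sym c≡d)) q<p })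
                                (place-sorted (decreasing v)) }

  -- Distinctness of the parts of equal color makes ⊐ total on a partition in 𝒞.
  compare : ∀ {x y : Part m} → IsPrimary (color x) → IsPrimary (color y) →
            (color x ≡ color y → size x ≢ size y) → x ⊐ y ⊎ y ⊐ x
  compare {x} {y} (p , refl) (q , refl) x≢y with <-cmp (size x) (size y) | Finₚ.<-cmp p q
  ... | tri< x<y _ _ | _             = inj₂ (inj₁ x<y)
  ... | tri> _ _ y<x | _             = inj₁ (inj₁ y<x)
  ... | tri≈ _ x≡y _ | tri< p<q _ _  = inj₂ (inj₂ (sym x≡y , p<q))
  ... | tri≈ _ x≡y _ | tri> _ _ q<p  = inj₁ (inj₂ (x≡y , q<p))
  ... | tri≈ _ x≡y _ | tri≈ _ refl _ = contradiction x≡y (x≢y refl)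

  comparable : ∀ {l} → All (IsPrimary ∘ color) l →
               AllPairs (λ x y → color x ≡ color y → size x ≢ size y) l →
               AllPairs (λ x y → x ⊐ y ⊎ y ⊐ x) l
  comparable []       []       = []
  comparable {x ∷ _} (p ∷ ps) (d ∷ ds) =
    All.zipWith (λ {y} (q , x≢y) → compare {x} {y} p q x≢y) (ps , d) ∷ comparable ps ds

  place-onto : ∀ π → InC u π → ∃ λ z → Valid z × place z ↭ parts π
  place-onto π π∈C
    with l , π↭l , l↘ ← sort (λ {x} {y} {z} → ⊐-trans {i = x} {y} {z})
                             (comparable (InC.allPrimary π∈C) (InC.distinct π∈C))
    with z , z↘ , refl ← sorted⇒place (All-resp-↭ π↭l (InC.allPrimary π∈C)) l↘ =
    z , valid z↘
      (λ i → trans (sym (#colored-place i z))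
               (trans (sym (↭-length (filter-↭ ((_≟ primary i) ∘ color) π↭l))) (InC.counts π∈C i)))
      (trans (sum-↭ (↭-map size (↭-sym π↭l))) (Partition.total π)) , ↭-sym π↭l

  chain-InD : ∀ {z} → Valid z →
              Σ (weight (chainOf (arrange z)) ≡ n) λ eq → InD u (partition (chainOf (arrange z)) eq)
  chain-InD {z} v = trans (weight-arrange z) (total v) , record
    { chain  = good⇒chain (arrange-good (decreasing v))
    ; no-1   = chainOf-no1 (arrange z)
    ; counts = λ i → sym (trans (#colored-chainOf i (arrange z))
                           (trans (cong (occurrences i) (word-arrange z)) (counts v i))) }

  chain-onto : ∀ π → InD u π → ∃ λ z → Valid z × chainOf (arrange z) ↭ parts π
  chain-onto (partition _ total≡n) π∈D
    with s , g , refl ← chain⇒good _ (InD.chain π∈D) (InD.no-1 π∈D)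
    with z , z↘ , refl ← arrange-surjective g =
    z , valid z↘
      (λ i → trans (cong (occurrences i) (sym (word-arrange z)))
               (trans (sym (#colored-chainOf i (arrange z))) (sym (InD.counts π∈D i))))
      (trans (sym (weight-arrange z)) total≡n) , ↭-refl

theorem1p4 : (m : ℕ) → 1 ≤ m → (u : Fin m → ℕ) (n : ℕ) →
    ∃ λ N → HasCardinality (𝒞 u n) N × HasCardinality (𝒟 u n) N
theorem1p4 m _ u n = length (valids u n) ,
  hasCardinality (valids u n) (valids-unique u n) (∈-valids⁻ u n) (∈-valids u n)
    place (place-InC u n) (place-sorted ∘ decreasing)
    (λ _ _ → place-injective) (place-onto u n) ,
  hasCardinality (valids u n) (valids-unique u n) (∈-valids⁻ u n) (∈-valids u n)
    (chainOf ∘ arrange) (chain-InD u n)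
    (λ v → Linked⇒AllPairs (λ {x} {y} {z} → ⊐-trans {i = x} {y} {z})
             (Linked.map (λ {x} {y} → ≫⇒⊐ {x = x} {y}) (good⇒chain (arrange-good (decreasing v)))))
    (λ v v′ eq → arrange-injective (decreasing v) (decreasing v′) (chainOf-injective eq))
    (chain-onto u n)
  where open Valid
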